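{- Let $\mathcal{P}(\mathbb{N})$ be Scott's graph model and $C:\mathcal{P}(\mathbb{N})\to\mathcal{P}(\mathbb{N})$, $C(A)=\mathbb{N}-A$, the complement function. (a) The set $\mathcal{P}(\mathbb{N})$ cannot be written as a countable union $\bigcup_{i\in\mathbb{N}}V_i$ such that $C$ is Scott continuous on each $V_i$ (i.e. each restriction $C|_{V_i}:V_i\to\mathcal{P}(\mathbb{N})$ is continuous, where $\mathcal{P}(\mathbb{N})$ has the Scott topology and $V_i$ the subspace topology). (b) The function $C$ is, relative to $\mathcal{P}(\mathbb{N})$, not computable in any function $F:\mathcal{P}(\mathbb{N})\to\mathcal{P}(\mathbb{N})$ with countable image; i.e. for every such $F$, $C$ is not representable in $\mathcal{P}(\mathbb{N})[F]$.
   Context: A partial combinatory algebra (pca) is a set $\mathcal{A}$ with a partial binary application $(a,b)\mapsto ab$ (associating to the left) such that there are $\mathsf{k},\mathsf{s}\in\mathcal{A}$ with, for all $a,b,c$: $\mathsf{k}ab=a$; $\mathsf{s}ab$ is defined; and whenever $(ac)(bc)$ is defined, $\mathsf{s}abc$ is defined and equals $(ac)(bc)$. A partial function $f:\mathcal{A}\to\mathcal{A}$ is representable in $\mathcal{A}$ if there is $a_f\in\mathcal{A}$ with $a_fa=f(a)$ for all $a$ in the domain of $f$. Every pca contains booleans $\mathsf{T},\mathsf{F}$ with a definition-by-cases element $D$ ($D\mathsf{T}ab=a$, $D\mathsf{F}ab=b$), and standard codings $[a,b]$ of pairs and $[a_0,\ldots,a_{n-1}]$ of finite sequences whose basic operations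 (length, projections, appending) are representable; fix such choices. For a pca $\mathcal{A}$ and a partial function $f:\mathcal{A}\to\mathcal{A}$, $\mathcal{A}[f]$ is the pca with underlying set $\mathcal{A}$ and application $\cdot_f$ defined by: $a\cdot_f b=c$ iff there is a finite sequence $e_0,\ldots,e_{n-1}$ in $\mathcal{A}$ (on each of which $f$ is defined) such that $a[b,f(e_0),\ldots,f(e_{i-1})]=[\mathsf{F},e_i]$ for all $i<n$ and $a[b,f(e_0),\ldots,f(e_{n-1})]=[\mathsf{T},c]$. Scott's graph model is the set $\mathcal{P}(\mathbb{N})$ of subsets of $\mathbb{N}$ with application $A\circ B=\{n\mid \exists m\,([m,n]\in A,\ e_m\subseteq B)\}$, where $[\cdot,\cdot]$ is a standard bijective pairing on $\mathbb{N}$ and $e_k$ is the finite set $p$ with $k=\sum_{i\in p}2^i$. The Scott topology on $\mathcal{P}(\mathbb{N})$ has as basis the sets $U_p=\{A\subseteq\mathbb{N}\mid p\subseteq A\}$ for finite $p\subseteq\mathbb{N}$. It is well known that the functions $\mathcal{P}(\mathbb{N})\to\mathcal{P}(\mathbb{N})$ representable in the graph model are exactly the Scott-continuous ones, and that partial representable functions are exactly those continuous on their domain. -}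

module Defs where

open import Level using (Level; _⊔_; 0ℓ) renaming (suc to lsuc)
open import Data.Nat using (ℕ; zero; suc; _+_; _*_; _^_; _<_; _≤_; s≤s; z≤n)
import Data.Nat.Properties as ℕₚ
open import Data.Nat.DivMod
open import Data.Nat.Divisibility using (divides-refl)
open import Data.Nat.Induction using (<-rec)
open import Data.Fin using (Fin; zero; suc; toℕ; fromℕ<)
open import Data.Fin.Properties using (toℕ-fromℕ<; toℕ<n)
open import Data.List using (List; []; _∷_; _++_; _∷ʳ_; map; take; tabulate; lookup; length)
open import Data.Nat.ListAction using (sum)
open import Data.List.Properties using (length-++; map-∘; length-tabulate; take-all)
open import Data.List.Membership.Propositional using () renaming (_∈_ to _∈ˡ_)
open import Data.List.Membership.Propositional.Properties
  using (∈-++⁺ˡ; ∈-++⁺ʳ; ∈-++⁻; ∈-map⁺; ∈-map⁻)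
open import Data.List.Relation.Unary.Any using (here; there)
open import Data.List.Relation.Unary.All.Properties using (¬Any⇒All¬)
open import Data.List.Relation.Unary.Unique.Propositional using (Unique; []; _∷_)
import Data.List.Relation.Unary.Unique.Propositional.Properties as Uniqueₚ
open import Data.List.Relation.Binary.Pointwise as Pw using (Pointwise; []; _∷_)
open import Data.Product using (Σ-syntax; ∃; ∃-syntax; _×_; _,_; proj₁; proj₂)
open import Data.Sum using (_⊎_; inj₁; inj₂)
open import Data.Empty using (⊥-elim)
open import Data.Vec.Functional using (Vector)
open import Function using (_∘_; id)
open import Function.Bundles using (_↔_; _⇔_; Inverse; Func; Injection; mk⇔)
open import Relation.Binary.Bundles using (Setoid)
open import Relation.Binary.Definitions using (tri<; tri≈; tri>)
import Relation.Binary.Construct.On as On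
open import Relation.Binary.PropositionalEquality as ≡ using (_≡_; refl; cong; cong₂; subst)
open import Relation.Nullary using (¬_; contradiction)
open import Relation.Unary using (Pred; _∈_; _⊆_; _≐_; ∁; _∪_; ⋃; ∅; ｛_｝)
open import Relation.Unary.Relation.Binary.Equality using (≐-setoid)

private variable
  c ℓ ℓ₁ ℓ₂ ℓ₃ : Level

-- The partial application is given by its graph: a · b ⇓ d means
-- "ab is defined and equal to d".

record PartialApplicativeStructure c ℓ₁ ℓ₂ : Set (lsuc (c ⊔ ℓ₁ ⊔ ℓ₂)) where
  infix 4 _·_⇓_ _·_·_⇓_ _·_·_·_⇓_
  field
    setoid : Setoid c ℓ₁
  open Setoid setoid public
    using (Carrier; _≈_) renaming (refl to ≈-refl; sym to ≈-sym; trans to ≈-trans)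
  field
    _·_⇓_        : Carrier → Carrier → Carrier → Set ℓ₂
    ⇓-resp       : ∀ {a a′ b b′ d d′} → a ≈ a′ → b ≈ b′ → d ≈ d′ →
                   a · b ⇓ d → a′ · b′ ⇓ d′
    ⇓-functional : ∀ {a b d d′} → a · b ⇓ d → a · b ⇓ d′ → d ≈ d′

  _·_·_⇓_ : Carrier → Carrier → Carrier → Carrier → Set (c ⊔ ℓ₂)
  a · b₁ · b₂ ⇓ d = ∃[ x ] ((a · b₁ ⇓ x) × (x · b₂ ⇓ d))

  _·_·_·_⇓_ : Carrier → Carrier → Carrier → Carrier → Carrier → Set (c ⊔ ℓ₂)
  a · b₁ · b₂ · b₃ ⇓ d = ∃[ x ] ((a · b₁ · b₂ ⇓ x) × (x · b₃ ⇓ d))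

record PCA c ℓ₁ ℓ₂ : Set (lsuc (c ⊔ ℓ₁ ⊔ ℓ₂)) where
  field
    structure : PartialApplicativeStructure c ℓ₁ ℓ₂
  open PartialApplicativeStructure structure public
  field
    k s       : Carrier
    k-law     : ∀ a b → k · a · b ⇓ a
    s-defined : ∀ a b → ∃[ x ] s · a · b ⇓ x
    s-law     : ∀ a b d {x y z} → a · d ⇓ x → b · d ⇓ y → x · y ⇓ z →
                s · a · b · d ⇓ z

-- Partial functions, again as graphs: maps a b means "f(a) is defined
-- and equal to b".

record PartialFunction (S : Setoid c ℓ₁) ℓ : Set (c ⊔ ℓ₁ ⊔ lsuc ℓ) where
  open Setoid S using (Carrier; _≈_)
  field
    maps            : Carrier → Carrier → Set ℓ
    maps-resp       : ∀ {a a′ b b′} → a ≈ a′ → b ≈ b′ → maps a b → maps a′ b′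
    maps-functional : ∀ {a b b′} → maps a b → maps a b′ → b ≈ b′

total : {S : Setoid c ℓ₁} → Func S S → PartialFunction S ℓ₁
total {S = S} f = record
  { maps            = λ a b → to a ≈ b
  ; maps-resp       = λ a≈a′ b≈b′ fa≈b → trans (sym (Func.cong f a≈a′)) (trans fa≈b b≈b′)
  ; maps-functional = λ fa≈b fa≈b′ → trans (sym fa≈b) fa≈b′
  }
  where open Setoid S
        open Func f using (to)

Representable : (𝒜 : PartialApplicativeStructure c ℓ₁ ℓ₂) →
                PartialFunction (PartialApplicativeStructure.setoid 𝒜) ℓ → Set _
Representable 𝒜 f = ∃[ r ] (∀ a b → maps a b → r · a ⇓ b)
  where open PartialApplicativeStructure 𝒜
        open PartialFunction f

-- Numerals serve as the values of the length operation and as the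
-- indices of the projections.

record Coding (𝒜 : PCA c ℓ₁ ℓ₂) : Set (c ⊔ ℓ₁ ⊔ ℓ₂) where
  open PCA 𝒜
  field
    T F D      : Carrier
    D-T        : ∀ a b → D · T · a · b ⇓ a
    D-F        : ∀ a b → D · F · a · b ⇓ b

    ⟪_,_⟫      : Carrier → Carrier → Carrier
    pair       : Carrier
    fst snd    : Carrier
    ⟪⟫-cong    : ∀ {a a′ b b′} → a ≈ a′ → b ≈ b′ → ⟪ a , b ⟫ ≈ ⟪ a′ , b′ ⟫
    pair-law   : ∀ a b → pair · a · b ⇓ ⟪ a , b ⟫
    fst-law    : ∀ a b → fst · ⟪ a , b ⟫ ⇓ a
    snd-law    : ∀ a b → snd · ⟪ a , b ⟫ ⇓ b

    num        : ℕ → Carrier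
    succ pred  : Carrier
    isZero     : Carrier
    succ-law   : ∀ n → succ · num n ⇓ num (suc n)
    pred-law   : ∀ n → pred · num (suc n) ⇓ num n
    isZero-0   : isZero · num 0 ⇓ T
    isZero-suc : ∀ n → isZero · num (suc n) ⇓ F

    seq        : List Carrier → Carrier
    len        : Carrier
    proj       : Carrier
    append     : Carrier
    seq-cong   : ∀ {as bs} → Pointwise _≈_ as bs → seq as ≈ seq bs
    len-law    : ∀ as → len · seq as ⇓ num (length as)
    proj-law   : ∀ as (i : Fin (length as)) → proj · seq as · num (toℕ i) ⇓ lookup as i
    append-law : ∀ as a → append · seq as · a ⇓ seq (as ∷ʳ a)

module Oracle {𝒜 : PCA c ℓ₁ ℓ₂} (K : Coding 𝒜)
              (f : PartialFunction (PCA.setoid 𝒜) ℓ₃) where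
  open PCA 𝒜
  open Coding K
  open PartialFunction f

  -- e lists the queries e₀,…,eₙ₋₁ and r the replies f(e₀),…,f(eₙ₋₁).
  infix 4 _·ᶠ_⇓_
  _·ᶠ_⇓_ : Carrier → Carrier → Carrier → Set (c ⊔ ℓ₂ ⊔ ℓ₃)
  a ·ᶠ b ⇓ d =
    ∃[ n ] Σ[ e ∈ Vector Carrier n ] Σ[ r ∈ Vector Carrier n ]
      ( (∀ i → maps (e i) (r i))
      × (∀ i → a · seq (b ∷ take (toℕ i) (tabulate r)) ⇓ ⟪ F , e i ⟫)
      × a · seq (b ∷ tabulate r) ⇓ ⟪ T , d ⟫ )

  private
    fst-inj : ∀ {a a′ b b′} → ⟪ a , b ⟫ ≈ ⟪ a′ , b′ ⟫ → a ≈ a′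
    fst-inj eq = ⇓-functional (fst-law _ _) (⇓-resp ≈-refl (≈-sym eq) ≈-refl (fst-law _ _))

    snd-inj : ∀ {a a′ b b′} → ⟪ a , b ⟫ ≈ ⟪ a′ , b′ ⟫ → b ≈ b′
    snd-inj eq = ⇓-functional (snd-law _ _) (⇓-resp ≈-refl (≈-sym eq) ≈-refl (snd-law _ _))

    trivial : T ≈ F → ∀ a b → a ≈ b
    trivial T≈F a b with D-T a b | D-F a b
    ... | x , (y , DT , ya) , xb | x′ , (y′ , DF , y′a) , x′b =
      ⇓-functional xb (⇓-resp (≈-sym x≈x′) ≈-refl ≈-refl x′b)
      where
      y≈y′ = ⇓-functional DT (⇓-resp ≈-refl (≈-sym T≈F) ≈-refl DF)
      x≈x′ = ⇓-functional ya (⇓-resp (≈-sym y≈y′) ≈-refl ≈-refl y′a)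

    take-≈ : ∀ {n n′} (r : Vector Carrier n) (r′ : Vector Carrier n′) m →
             (∀ i i′ → toℕ i ≡ toℕ i′ → toℕ i < m → r i ≈ r′ i′) →
             m ≤ n → m ≤ n′ →
             Pointwise _≈_ (take m (tabulate r)) (take m (tabulate r′))
    take-≈ r r′ zero h _ _ = []
    take-≈ {suc n} {suc n′} r r′ (suc m) h (s≤s p) (s≤s q) =
      h zero zero refl (s≤s z≤n) ∷
      take-≈ (r ∘ suc) (r′ ∘ suc) m
        (λ i i′ eq lt → h (suc i) (suc i′) (cong suc eq) (s≤s lt)) p q

    take-tabulate : ∀ {n} (r : Vector Carrier n) → take n (tabulate r) ≡ tabulate r
    take-tabulate {n} r = take-all n (tabulate r) (ℕₚ.≤-reflexive (length-tabulate r))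

    module _ {a b n n′} {e r : Vector Carrier n} {e′ r′ : Vector Carrier n′}
             (m : ∀ i → maps (e i) (r i)) (m′ : ∀ i → maps (e′ i) (r′ i))
             (q : ∀ i → a · seq (b ∷ take (toℕ i) (tabulate r)) ⇓ ⟪ F , e i ⟫)
             (q′ : ∀ i → a · seq (b ∷ take (toℕ i) (tabulate r′)) ⇓ ⟪ F , e′ i ⟫) where

      agree : ∀ k i i′ → toℕ i ≡ toℕ i′ → toℕ i < k → r i ≈ r′ i′
      agree (suc k) i i′ eq (s≤s i≤k) =
        maps-functional (m i) (maps-resp (≈-sym e≈e′) ≈-refl (m′ i′))
        where
        prefix : Pointwise _≈_ (take (toℕ i) (tabulate r)) (take (toℕ i) (tabulate r′))
        prefix = take-≈ r r′ (toℕ i)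
          (λ j j′ eq′ lt → agree k j j′ eq′ (ℕₚ.<-≤-trans lt i≤k))
          (ℕₚ.<⇒≤ (toℕ<n i))
          (subst (_≤ n′) (≡.sym eq) (ℕₚ.<⇒≤ (toℕ<n i′)))
        e≈e′ : e i ≈ e′ i′
        e≈e′ = snd-inj (⇓-functional (q i)
          (⇓-resp ≈-refl (≈-sym (seq-cong (≈-refl ∷ prefix))) ≈-refl
            (subst (λ t → a · seq (b ∷ take t (tabulate r′)) ⇓ ⟪ F , e′ i′ ⟫)
                   (≡.sym eq) (q′ i′))))

      halt≤ : ∀ {d} → n ≤ n′ → a · seq (b ∷ tabulate r) ⇓ ⟪ T , d ⟫ →
              a · seq (b ∷ take n (tabulate r′)) ⇓ ⟪ T , d ⟫
      halt≤ {d} n≤n′ h = ⇓-resp ≈-refl (seq-cong (≈-refl ∷ take-≈ r r′ n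
          (λ i i′ eq _ → agree (suc (toℕ i)) i i′ eq ℕₚ.≤-refl) ℕₚ.≤-refl n≤n′)) ≈-refl
        (subst (λ t → a · seq (b ∷ t) ⇓ ⟪ T , d ⟫) (≡.sym (take-tabulate r)) h)

      no-more : ∀ {d} → n < n′ → a · seq (b ∷ tabulate r) ⇓ ⟪ T , d ⟫ → T ≈ F
      no-more n<n′ h = fst-inj (⇓-functional (halt≤ (ℕₚ.<⇒≤ n<n′) h)
        (subst (λ t → a · seq (b ∷ take t (tabulate r′)) ⇓ ⟪ F , e′ (fromℕ< n<n′) ⟫)
               (toℕ-fromℕ< n<n′) (q′ (fromℕ< n<n′))))

    ·ᶠ-functional : ∀ {a b d d′} → a ·ᶠ b ⇓ d → a ·ᶠ b ⇓ d′ → d ≈ d′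
    ·ᶠ-functional {a} {b} {d} {d′} (n , e , r , m , q , h) (n′ , e′ , r′ , m′ , q′ , h′)
      with ℕₚ.<-cmp n n′
    ... | tri< n<n′ _ _ = trivial (no-more m m′ q q′ n<n′ h) d d′
    ... | tri> _ _ n′<n = trivial (no-more m′ m q′ q n′<n h′) d d′
    ... | tri≈ _ refl _ = snd-inj (⇓-functional (halt≤ m m′ q q′ ℕₚ.≤-refl h)
      (subst (λ t → a · seq (b ∷ t) ⇓ ⟪ T , d′ ⟫) (≡.sym (take-tabulate r′)) h′))

    ·ᶠ-resp : ∀ {a a′ b b′ d d′} → a ≈ a′ → b ≈ b′ → d ≈ d′ →
              a ·ᶠ b ⇓ d → a′ ·ᶠ b′ ⇓ d′
    ·ᶠ-resp a≈ b≈ d≈ (n , e , r , m , q , h) =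
      n , e , r , m ,
      (λ i → ⇓-resp a≈ (seq-cong (b≈ ∷ Pw.refl ≈-refl)) ≈-refl (q i)) ,
      ⇓-resp a≈ (seq-cong (b≈ ∷ Pw.refl ≈-refl)) (⟪⟫-cong ≈-refl d≈) h

  oracleStructure : PartialApplicativeStructure c ℓ₁ (c ⊔ ℓ₂ ⊔ ℓ₃)
  oracleStructure = record
    { setoid       = setoid
    ; _·_⇓_        = _·ᶠ_⇓_
    ; ⇓-resp       = ·ᶠ-resp
    ; ⇓-functional = ·ᶠ-functional
    }

𝒫ℕ : Set₁
𝒫ℕ = Pred ℕ 0ℓ

𝒫ℕ-setoid : Setoid _ _
𝒫ℕ-setoid = ≐-setoid ℕ 0ℓ

fin : List ℕ → 𝒫ℕ
fin p n = n ∈ˡ p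

U : List ℕ → Pred 𝒫ℕ 0ℓ
U p A = fin p ⊆ A

-- Predicates at level 0ℓ suffice: they contain, up to ≐, the union of
-- U p over p ∈ I for every I : Pred (List ℕ) 0ℓ, and when O is open at
-- level 0ℓ it is the union over I = { p ∣ fin p ∈ O }.
ScottOpen : Pred 𝒫ℕ 0ℓ → Set₁
ScottOpen O = ∀ A → A ∈ O → ∃[ p ] (A ∈ U p × U p ⊆ O)

-- Continuity of f restricted to V for the subspace topology on V: the
-- preimage in V of an open set is the trace on V of an open set W.
ContinuousOn : Pred 𝒫ℕ ℓ → (𝒫ℕ → 𝒫ℕ) → Set (lsuc 0ℓ ⊔ ℓ)
ContinuousOn V f =
  ∀ O → ScottOpen O → ∃[ W ] (ScottOpen W × (∀ A → A ∈ V → f A ∈ O ⇔ A ∈ W))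

complement : Func 𝒫ℕ-setoid 𝒫ℕ-setoid
complement = record
  { to   = ∁
  ; cong = λ (A⊆B , B⊆A) → (λ n∉A n∈B → n∉A (B⊆A n∈B)) , (λ n∉B n∈A → n∉B (A⊆B n∈A))
  }

imageSetoid : {S T : Setoid c ℓ} → Func S T → Setoid _ _
imageSetoid {S = S} {T = T} f =
  On.setoid {B = ∃[ b ] ∃[ a ] Setoid._≈_ T (Func.to f a) b} T proj₁

-- Countable includes finite.
CountableImage : {S T : Setoid c ℓ} → Func S T → Set _
CountableImage f = Injection (imageSetoid f) (≡.setoid ℕ)

-- i ∈ e k iff the i-th binary digit of k is 1.
e : ℕ → 𝒫ℕ
e k zero    = k % 2 ≡ 1
e k (suc i) = e (k / 2) i

private
  digit : ∀ r q → r < 2 → (r + q * 2) % 2 ≡ r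
  digit r q r<2 = ≡.trans ([m+kn]%n≡m%n r q 2) (m<n⇒m%n≡m r<2)

  rest : ∀ r q → r < 2 → (r + q * 2) / 2 ≡ q
  rest r q r<2 = ≡.trans (+-distrib-/-∣ʳ r (divides-refl q))
    (cong₂ _+_ (m<n⇒m/n≡0 r<2) (m*n/n≡m q 2))

  ∉-e-0 : ∀ i → ¬ i ∈ e 0
  ∉-e-0 (suc i) = ∉-e-0 i

  sum-map-suc : ∀ p → sum (map (2 ^_) (map suc p)) ≡ sum (map (2 ^_) p) * 2
  sum-map-suc []      = refl
  sum-map-suc (i ∷ p) = ≡.trans
    (cong₂ _+_ (ℕₚ.*-comm 2 (2 ^ i)) (sum-map-suc p))
    (≡.sym (ℕₚ.*-distribʳ-+ 2 (2 ^ i) (sum (map (2 ^_) p))))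

  0∉map-suc : ∀ p → ¬ 0 ∈ˡ map suc p
  0∉map-suc p 0∈ with ∈-map⁻ suc 0∈
  ... | _ , _ , ()

-- e k is the finite set p with k = Σ_{i ∈ p} 2 ^ i.
e-spec : ∀ k → ∃[ p ] (Unique p × e k ≐ fin p × k ≡ sum (map (2 ^_) p))
e-spec = <-rec _ step
  where
  Spec : ℕ → Set
  Spec k = ∃[ p ] (Unique p × e k ≐ fin p × k ≡ sum (map (2 ^_) p))
  step : ∀ k → (∀ {j} → j < k → Spec j) → Spec k
  step zero      _   = [] , [] , ((λ {i} i∈ → ⊥-elim (∉-e-0 i i∈)) , λ ()) , refl
  step k@(suc _) rec
    with rec {k / 2} (m/n<m k 2 (s≤s (s≤s z≤n)))
       | k % 2 in k%2 | m%n<n k 2 | m≡m%n+[m/n]*n k 2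
  ... | p , u , (to , from) , eq | 0 | _ | k≡ =
    map suc p , Uniqueₚ.map⁺ ℕₚ.suc-injective u ,
    ((λ { {zero}  z → contradiction (≡.trans (≡.sym k%2) z) λ ()
        ; {suc i} z → ∈-map⁺ suc (to z) })
    , (λ { {zero}  z → contradiction z (0∉map-suc p)
         ; {suc i} z → shift z })) ,
    ≡.trans k≡ (≡.trans (cong (_* 2) eq) (≡.sym (sum-map-suc p)))
    where
    shift : ∀ {i} → suc i ∈ˡ map suc p → e (k / 2) i
    shift z with ∈-map⁻ suc z
    ... | _ , i∈p , refl = from i∈p
  ... | p , u , (to , from) , eq | 1 | _ | k≡ =
    0 ∷ map suc p , ¬Any⇒All¬ _ (0∉map-suc p) ∷ Uniqueₚ.map⁺ ℕₚ.suc-injective u ,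
    ((λ { {zero}  z → here refl
        ; {suc i} z → there (∈-map⁺ suc (to z)) })
    , (λ { {zero}  z → k%2
         ; {suc i} (there z) → shift z })) ,
    ≡.trans k≡ (cong suc (≡.trans (cong (_* 2) eq) (≡.sym (sum-map-suc p))))
    where
    shift : ∀ {i} → suc i ∈ˡ map suc p → e (k / 2) i
    shift z with ∈-map⁻ suc z
    ... | _ , i∈p , refl = from i∈p
  ... | _ | suc (suc _) | s≤s (s≤s ()) | _

e-surjective : ∀ p → ∃[ k ] e k ≐ fin p
e-surjective []      = 0 , (λ {i} i∈ → ⊥-elim (∉-e-0 i i∈)) , λ ()
e-surjective (i ∷ p) with e-surjective p
... | k , to , from = insert i k ,
    (λ {j} z → back j (insert⁻ i k j z)) ,
    (λ { (here refl) → insert⁺ˡ i k ; {j} (there z) → insert⁺ʳ i k j (from z) })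
  where
  insert : ℕ → ℕ → ℕ
  insert zero    k = 1 + (k / 2) * 2
  insert (suc i) k = k % 2 + insert i (k / 2) * 2

  rest′ : ∀ i k → (k % 2 + insert i (k / 2) * 2) / 2 ≡ insert i (k / 2)
  rest′ i k = rest (k % 2) (insert i (k / 2)) (m%n<n k 2)

  insert⁻ : ∀ i k j → j ∈ e (insert i k) → j ≡ i ⊎ j ∈ e k
  insert⁻ zero    k zero    _ = inj₁ refl
  insert⁻ zero    k (suc j) z = inj₂ (subst (λ t → e t j) (rest 1 (k / 2) (s≤s (s≤s z≤n))) z)
  insert⁻ (suc i) k zero    z =
    inj₂ (≡.trans (≡.sym (digit (k % 2) (insert i (k / 2)) (m%n<n k 2))) z)
  insert⁻ (suc i) k (suc j) z
    with insert⁻ i (k / 2) j (subst (λ t → e t j) (rest′ i k) z)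
  ... | inj₁ eq = inj₁ (cong suc eq)
  ... | inj₂ y  = inj₂ y

  insert⁺ˡ : ∀ i k → i ∈ e (insert i k)
  insert⁺ˡ zero    k = digit 1 (k / 2) (s≤s (s≤s z≤n))
  insert⁺ˡ (suc i) k = subst (λ t → e t i) (≡.sym (rest′ i k)) (insert⁺ˡ i (k / 2))

  insert⁺ʳ : ∀ i k j → j ∈ e k → j ∈ e (insert i k)
  insert⁺ʳ zero    k zero    z = digit 1 (k / 2) (s≤s (s≤s z≤n))
  insert⁺ʳ zero    k (suc j) z =
    subst (λ t → e t j) (≡.sym (rest 1 (k / 2) (s≤s (s≤s z≤n)))) z
  insert⁺ʳ (suc i) k zero    z = ≡.trans (digit (k % 2) (insert i (k / 2)) (m%n<n k 2)) z
  insert⁺ʳ (suc i) k (suc j) z =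
    subst (λ t → e t j) (≡.sym (rest′ i k)) (insert⁺ʳ i (k / 2) j z)

  back : ∀ j → j ≡ i ⊎ j ∈ e k → j ∈ˡ i ∷ p
  back j (inj₁ eq) = here eq
  back j (inj₂ z)  = there (to z)

-- A map is finitary when it is Scott continuous on all of 𝒫(ℕ), stated
-- pointwise.
record Finitary (Φ : 𝒫ℕ → 𝒫ℕ) : Set₁ where
  field
    mono   : ∀ {A B} → A ⊆ B → Φ A ⊆ Φ B
    finite : ∀ {A n} → n ∈ Φ A → ∃[ p ] (fin p ⊆ A × n ∈ Φ (fin p))

  finite* : ∀ {A} q → fin q ⊆ Φ A → ∃[ p ] (fin p ⊆ A × fin q ⊆ Φ (fin p))
  finite* []      _ = [] , (λ ()) , λ ()
  finite* (n ∷ q) h with finite (h (here refl)) | finite* q (λ z → h (there z))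
  ... | p , p⊆A , n∈ | p′ , p′⊆A , q⊆ = p ++ p′ ,
    (λ z → case (∈-++⁻ p z) p⊆A p′⊆A) ,
    (λ { (here refl) → mono ∈-++⁺ˡ n∈ ; (there z) → mono (∈-++⁺ʳ p) (q⊆ z) })
    where
    case : ∀ {X Y Z : Set} → X ⊎ Y → (X → Z) → (Y → Z) → Z
    case (inj₁ x) f _ = f x
    case (inj₂ y) _ g = g y

open Finitary

finitary-id : Finitary id
finitary-id .mono A⊆B = A⊆B
finitary-id .finite {n = n} n∈A =
  n ∷ [] , (λ { (here refl) → n∈A }) , here refl

finitary-const : ∀ B → Finitary (λ _ → B)
finitary-const B .mono _ = id
finitary-const B .finite n∈B = [] , (λ ()) , n∈B

module GraphModel (pairing : (ℕ × ℕ) ↔ ℕ) where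

  open Inverse pairing using (strictlyInverseʳ) renaming (to to ⟨_⟩; from to unpair)

  infixl 7 _•_
  _•_ : 𝒫ℕ → 𝒫ℕ → 𝒫ℕ
  (A • B) n = ∃[ m ] (⟨ m , n ⟩ ∈ A × e m ⊆ B)

  •-mono : ∀ {A A′ B B′ : 𝒫ℕ} → A ⊆ A′ → B ⊆ B′ → A • B ⊆ A′ • B′
  •-mono A⊆ B⊆ (m , z , em⊆) = m , A⊆ z , λ x → B⊆ (em⊆ x)

  •-cong : ∀ {A A′ B B′ : 𝒫ℕ} → A ≐ A′ → B ≐ B′ → A • B ≐ A′ • B′
  •-cong {A} {A′} {B} {B′} (A⊆ , A⊇) (B⊆ , B⊇) =
    •-mono {A} {A′} {B} {B′} A⊆ B⊆ , •-mono {A′} {A} {B′} {B} A⊇ B⊇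

  graph : (𝒫ℕ → 𝒫ℕ) → 𝒫ℕ
  graph Φ x = proj₂ (unpair x) ∈ Φ (e (proj₁ (unpair x)))

  graph-β : ∀ {Φ} → Finitary Φ → ∀ B → graph Φ • B ≐ Φ B
  graph-β {Φ} φ B =
    (λ {n} (m , z , em⊆B) → mono φ em⊆B
      (subst (λ y → proj₂ y ∈ Φ (e (proj₁ y))) (strictlyInverseʳ (m , n)) z)) ,
    λ {n} n∈ → from-finite n (finite φ n∈)
    where
    from-finite : ∀ n → ∃[ p ] (fin p ⊆ B × n ∈ Φ (fin p)) → n ∈ graph Φ • B
    from-finite n (p , p⊆B , z) with e-surjective p
    ... | m , em⊆p , p⊆em = m ,
      subst (λ y → proj₂ y ∈ Φ (e (proj₁ y))) (≡.sym (strictlyInverseʳ (m , n)))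
        (mono φ p⊆em z) ,
      λ x → p⊆B (em⊆p x)

  finitary-graph : ∀ {Φ : 𝒫ℕ → 𝒫ℕ → 𝒫ℕ} → (∀ B → Finitary (λ A → Φ A B)) →
                   Finitary (λ A → graph (Φ A))
  finitary-graph φ .mono A⊆ {x} = mono (φ (e (proj₁ (unpair x)))) A⊆
  finitary-graph φ .finite {n = x} = finite (φ (e (proj₁ (unpair x))))

  finitary-• : ∀ {Φ Ψ} → Finitary Φ → Finitary Ψ → Finitary (λ A → Φ A • Ψ A)
  finitary-• {Φ} {Ψ} φ ψ .mono {A} {B} A⊆ =
    •-mono {Φ A} {Φ B} {Ψ A} {Ψ B} (mono φ A⊆) (mono ψ A⊆)
  finitary-• φ ψ .finite (m , z , em⊆) with e-spec m
  ... | q , _ , (em⊆q , q⊆em) , _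
    with finite φ z | finite* ψ q (λ x → em⊆ (q⊆em x))
  ... | p , p⊆A , z′ | p′ , p′⊆A , q⊆ = p ++ p′ ,
    (λ x → split (∈-++⁻ p x)) ,
    m , mono φ ∈-++⁺ˡ z′ , λ x → mono ψ (∈-++⁺ʳ p) (q⊆ (em⊆q x))
    where
    split : ∀ {x} → x ∈ˡ p ⊎ x ∈ˡ p′ → _
    split (inj₁ x) = p⊆A x
    split (inj₂ x) = p′⊆A x

  private
    ≐-trans : ∀ {A B C : 𝒫ℕ} → A ≐ B → B ≐ C → A ≐ C
    ≐-trans = Setoid.trans 𝒫ℕ-setoid
    ≐-sym : ∀ {A B : 𝒫ℕ} → A ≐ B → B ≐ A
    ≐-sym = Setoid.sym 𝒫ℕ-setoid
    ≐-refl : ∀ {A : 𝒫ℕ} → A ≐ A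
    ≐-refl = Setoid.refl 𝒫ℕ-setoid

  graph₂ : (𝒫ℕ → 𝒫ℕ → 𝒫ℕ) → 𝒫ℕ
  graph₂ Φ = graph λ A → graph (Φ A)

  graph₃ : (𝒫ℕ → 𝒫ℕ → 𝒫ℕ → 𝒫ℕ) → 𝒫ℕ
  graph₃ Φ = graph λ A → graph₂ (Φ A)

  graph₂-β : ∀ {Φ} → (∀ B → Finitary (λ A → Φ A B)) → (∀ A → Finitary (Φ A)) →
             ∀ A B → graph₂ Φ • A • B ≐ Φ A B
  graph₂-β φ₁ φ₂ A B =
    ≐-trans (•-cong (graph-β (finitary-graph φ₁) A) ≐-refl) (graph-β (φ₂ A) B)

  graph₃-β : ∀ {Φ} → (∀ B C → Finitary (λ A → Φ A B C)) →
             (∀ A C → Finitary (λ B → Φ A B C)) → (∀ A B → Finitary (Φ A B)) →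
             ∀ A B C → graph₃ Φ • A • B • C ≐ Φ A B C
  graph₃-β φ₁ φ₂ φ₃ A B C = ≐-trans
    (•-cong (•-cong (graph-β (finitary-graph λ B′ → finitary-graph (φ₁ B′)) A) ≐-refl) ≐-refl)
    (graph₂-β (φ₂ A) (φ₃ A) B C)

  pca : PCA _ _ _
  pca = record
    { structure = record
      { setoid       = 𝒫ℕ-setoid
      ; _·_⇓_        = λ A B C → A • B ≐ C
      ; ⇓-resp       = λ A≐ B≐ C≐ eq →
          ≐-trans (•-cong (≐-sym A≐) (≐-sym B≐)) (≐-trans eq C≐)
      ; ⇓-functional = λ eq eq′ → ≐-trans (≐-sym eq) eq′
      }
    ; k         = graph₂ λ A _ → A
    ; s         = graph₃ λ A B C → (A • C) • (B • C)
    ; k-law     = λ A B → _ , ≐-refl ,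
        graph₂-β (λ _ → finitary-id) finitary-const A B
    ; s-defined = λ A B → _ , _ , ≐-refl , ≐-refl
    ; s-law     = λ A B C AC BC ACBC → _ , (_ , ≐-refl , ≐-refl) , ≐-trans
        (graph₃-β
          (λ B C → finitary-• {λ A → A • C} (finitary-• finitary-id (finitary-const C))
                                            (finitary-const (B • C)))
          (λ A C → finitary-• {Ψ = λ B → B • C} (finitary-const (A • C))
                                                (finitary-• finitary-id (finitary-const C)))
          (λ A B → finitary-• {A •_} {B •_} (finitary-• (finitary-const A) finitary-id)
                                            (finitary-• (finitary-const B) finitary-id))
          A B C)
        (≐-trans (•-cong AC BC) ACBC)
    }

  -- The graph model has a coding: quantifying over all of them is not
  -- vacuous.

  guard : ℕ → 𝒫ℕ → 𝒫ℕ → 𝒫ℕ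
  guard i X Y n = i ∈ X × n ∈ Y

  finitary-guard : ∀ i {Φ Ψ} → Finitary Φ → Finitary Ψ →
                   Finitary (λ A → guard i (Φ A) (Ψ A))
  finitary-guard i φ ψ .mono A⊆ (x , y) = mono φ A⊆ x , mono ψ A⊆ y
  finitary-guard i φ ψ .finite {A} (x , y) with finite φ x | finite ψ y
  ... | p , p⊆A , x′ | q , q⊆A , y′ =
    p ++ q , (λ z → split (∈-++⁻ p z)) , mono φ ∈-++⁺ˡ x′ , mono ψ (∈-++⁺ʳ p) y′
    where
    split : ∀ {n} → n ∈ˡ p ⊎ n ∈ˡ q → n ∈ A
    split (inj₁ z) = p⊆A z
    split (inj₂ z) = q⊆A z

  finitary-∪ : ∀ {Φ Ψ : 𝒫ℕ → 𝒫ℕ} → Finitary Φ → Finitary Ψ → Finitary (λ A → Φ A ∪ Ψ A)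
  finitary-∪ φ ψ .mono A⊆ (inj₁ x) = inj₁ (mono φ A⊆ x)
  finitary-∪ φ ψ .mono A⊆ (inj₂ y) = inj₂ (mono ψ A⊆ y)
  finitary-∪ φ ψ .finite (inj₁ x) with finite φ x
  ... | p , p⊆A , x′ = p , p⊆A , inj₁ x′
  finitary-∪ φ ψ .finite (inj₂ y) with finite ψ y
  ... | p , p⊆A , y′ = p , p⊆A , inj₂ y′

  finitary-⋃ : ∀ {Φ : ℕ → 𝒫ℕ → 𝒫ℕ} → (∀ i → Finitary (Φ i)) →
               Finitary (λ A → ⋃ ℕ λ i → Φ i A)
  finitary-⋃ φ .mono A⊆ (i , x) = i , mono (φ i) A⊆ x
  finitary-⋃ φ .finite (i , x) with finite (φ i) x
  ... | p , p⊆A , x′ = p , p⊆A , i , x′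

  bundle : (ℕ → 𝒫ℕ) → 𝒫ℕ
  bundle G x = G (proj₁ (unpair x)) (proj₂ (unpair x))

  component : ℕ → 𝒫ℕ → 𝒫ℕ
  component j X n = ⟨ j , n ⟩ ∈ X

  component-bundle : ∀ j G → component j (bundle G) ≐ G j
  component-bundle j G =
    (λ {n} → subst (λ y → proj₂ y ∈ G (proj₁ y)) (strictlyInverseʳ (j , n))) ,
    (λ {n} → subst (λ y → proj₂ y ∈ G (proj₁ y)) (≡.sym (strictlyInverseʳ (j , n))))

  bundle-cong : ∀ {G H : ℕ → 𝒫ℕ} → (∀ j → G j ≐ H j) → bundle G ≐ bundle H
  bundle-cong eq = (λ {x} → proj₁ (eq (proj₁ (unpair x)))) ,
                   (λ {x} → proj₂ (eq (proj₁ (unpair x))))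

  finitary-bundle : ∀ {G : 𝒫ℕ → ℕ → 𝒫ℕ} → (∀ j → Finitary (λ A → G A j)) →
                    Finitary (λ A → bundle (G A))
  finitary-bundle γ .mono A⊆ {x} = mono (γ (proj₁ (unpair x))) A⊆
  finitary-bundle γ .finite {n = x} = finite (γ (proj₁ (unpair x)))

  finitary-component : ∀ j → Finitary (component j)
  finitary-component j .mono A⊆ = A⊆
  finitary-component j .finite {n = n} z =
    ⟨ j , n ⟩ ∷ [] , (λ { (here refl) → z }) , here refl

  private
    sucOp predOp isZeroOp : 𝒫ℕ → 𝒫ℕ
    sucOp X    = ⋃ ℕ λ i → guard i X ｛ suc i ｝
    predOp X n = suc n ∈ X
    isZeroOp X = guard 0 X ｛ 1 ｝ ∪ ⋃ ℕ λ i → guard (suc i) X ｛ 0 ｝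

    condOp : 𝒫ℕ → 𝒫ℕ → 𝒫ℕ → 𝒫ℕ
    condOp B X Y = guard 1 B X ∪ guard 0 B Y

    pairOp : 𝒫ℕ → 𝒫ℕ → ℕ → 𝒫ℕ
    pairOp A B 0             = A
    pairOp A B 1             = B
    pairOp A B (suc (suc _)) = ∅

    nth : List 𝒫ℕ → ℕ → 𝒫ℕ
    nth []       _       = ∅
    nth (A ∷ As) zero    = A
    nth (A ∷ As) (suc i) = nth As i

    entries : List 𝒫ℕ → ℕ → 𝒫ℕ
    entries As zero    = ｛ length As ｝
    entries As (suc i) = nth As i

    projOp : 𝒫ℕ → 𝒫ℕ → 𝒫ℕ
    projOp X I = ⋃ ℕ λ i → guard i I (component (suc i) X)

    appendOp : 𝒫ℕ → 𝒫ℕ → ℕ → 𝒫ℕ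
    appendOp X A zero    = sucOp (component 0 X)
    appendOp X A (suc i) = component (suc i) X ∪ guard i (component 0 X) A

    finitary-sucOp : ∀ {Φ} → Finitary Φ → Finitary (λ A → sucOp (Φ A))
    finitary-sucOp φ = finitary-⋃ λ i → finitary-guard i φ (finitary-const _)

    finitary-predOp : Finitary predOp
    finitary-predOp .mono A⊆ = A⊆
    finitary-predOp .finite {n = n} z = suc n ∷ [] , (λ { (here refl) → z }) , here refl

    nth-cong : ∀ {As Bs} → Pointwise _≐_ As Bs → ∀ i → nth As i ≐ nth Bs i
    nth-cong []         i       = ≐-refl {∅}
    nth-cong (eq ∷ eqs) zero    = eq
    nth-cong (eq ∷ eqs) (suc i) = nth-cong eqs i

    entries-cong : ∀ {As Bs} → Pointwise _≐_ As Bs → ∀ i → entries As i ≐ entries Bs i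
    entries-cong eqs zero    = (λ z → ≡.trans (≡.sym (Pw.Pointwise-length eqs)) z) ,
                               (λ z → ≡.trans (Pw.Pointwise-length eqs) z)
    entries-cong eqs (suc i) = nth-cong eqs i

    nth-lookup : ∀ As (i : Fin (length As)) → nth As (toℕ i) ≡ lookup As i
    nth-lookup (A ∷ As) zero    = refl
    nth-lookup (A ∷ As) (suc i) = nth-lookup As i

    nth-∷ʳ⁺ : ∀ As A i {n} → n ∈ nth As i ⊎ (length As ≡ i × n ∈ A) → n ∈ nth (As ∷ʳ A) i
    nth-∷ʳ⁺ []       A zero    (inj₂ (_ , z))  = z
    nth-∷ʳ⁺ (_ ∷ As) A zero    (inj₁ z)        = z
    nth-∷ʳ⁺ (_ ∷ As) A (suc i) (inj₁ z)        = nth-∷ʳ⁺ As A i (inj₁ z)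
    nth-∷ʳ⁺ (_ ∷ As) A (suc i) (inj₂ (eq , z)) =
      nth-∷ʳ⁺ As A i (inj₂ (ℕₚ.suc-injective eq , z))

    nth-∷ʳ⁻ : ∀ As A i {n} → n ∈ nth (As ∷ʳ A) i → n ∈ nth As i ⊎ (length As ≡ i × n ∈ A)
    nth-∷ʳ⁻ []       A zero    z = inj₂ (refl , z)
    nth-∷ʳ⁻ (_ ∷ As) A zero    z = inj₁ z
    nth-∷ʳ⁻ (_ ∷ As) A (suc i) z with nth-∷ʳ⁻ As A i z
    ... | inj₁ y        = inj₁ y
    ... | inj₂ (eq , y) = inj₂ (cong suc eq , y)

    appendOp-entries : ∀ As A j → appendOp (bundle (entries As)) A j ≐ entries (As ∷ʳ A) j
    appendOp-entries As A zero =
      (λ { (i , z , eq) → ≡.trans len-∷ʳ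
             (≡.trans (cong suc (proj₁ (component-bundle 0 (entries As)) z)) eq) }) ,
      (λ eq → length As , proj₂ (component-bundle 0 (entries As)) refl ,
              ≡.trans (≡.sym len-∷ʳ) eq)
      where
      len-∷ʳ : length (As ∷ʳ A) ≡ suc (length As)
      len-∷ʳ = ≡.trans (length-++ As) (ℕₚ.+-comm (length As) 1)
    appendOp-entries As A (suc j) =
      (λ { (inj₁ z)       → nth-∷ʳ⁺ As A j
             (inj₁ (proj₁ (component-bundle (suc j) (entries As)) z))
         ; (inj₂ (z , y)) → nth-∷ʳ⁺ As A j
             (inj₂ (proj₁ (component-bundle 0 (entries As)) z , y)) }) ,
      (λ z → back (nth-∷ʳ⁻ As A j z))
      where
      back : ∀ {n} → n ∈ nth As j ⊎ (length As ≡ j × n ∈ A) →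
             n ∈ appendOp (bundle (entries As)) A (suc j)
      back (inj₁ z)        = inj₁ (proj₂ (component-bundle (suc j) (entries As)) z)
      back (inj₂ (eq , z)) = inj₂ (proj₂ (component-bundle 0 (entries As)) eq , z)

  coding : Coding pca
  coding = record
    { T          = ｛ 1 ｝
    ; F          = ｛ 0 ｝
    ; D          = graph₃ condOp
    ; D-T        = λ A B → _ , (_ , ≐-refl , ≐-refl) , ≐-trans (condOp-β ｛ 1 ｝ A B)
        ((λ { (inj₁ (_ , z)) → z ; (inj₂ (() , _)) }) , λ z → inj₁ (refl , z))
    ; D-F        = λ A B → _ , (_ , ≐-refl , ≐-refl) , ≐-trans (condOp-β ｛ 0 ｝ A B)
        ((λ { (inj₁ (() , _)) ; (inj₂ (_ , z)) → z }) , λ z → inj₂ (refl , z))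
    ; ⟪_,_⟫      = λ A B → bundle (pairOp A B)
    ; pair       = graph₂ λ A B → bundle (pairOp A B)
    ; fst        = graph (component 0)
    ; snd        = graph (component 1)
    ; ⟪⟫-cong    = λ {A} {A′} {B} {B′} A≐ B≐ →
        bundle-cong {pairOp A B} {pairOp A′ B′} λ { 0 → A≐ ; 1 → B≐ ; (suc (suc _)) → ≐-refl {∅} }
    ; pair-law   = λ A B → _ , ≐-refl , graph₂-β {λ A B → bundle (pairOp A B)}
        (λ B → finitary-bundle {λ A → pairOp A B} λ { 0 → finitary-id ; 1 → finitary-const B
                                 ; (suc (suc _)) → finitary-const ∅ })
        (λ A → finitary-bundle {pairOp A} λ { 0 → finitary-const A ; 1 → finitary-id
                                 ; (suc (suc _)) → finitary-const ∅ })
        A B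
    ; fst-law    = λ A B → ≐-trans (graph-β (finitary-component 0) _)
        (component-bundle 0 (pairOp A B))
    ; snd-law    = λ A B → ≐-trans (graph-β (finitary-component 1) _)
        (component-bundle 1 (pairOp A B))
    ; num        = λ n → ｛ n ｝
    ; succ       = graph sucOp
    ; pred       = graph predOp
    ; isZero     = graph isZeroOp
    ; succ-law   = λ n → ≐-trans (graph-β (finitary-sucOp finitary-id) ｛ n ｝)
        ((λ { (_ , refl , eq) → eq }) , λ eq → n , refl , eq)
    ; pred-law   = λ n → ≐-trans (graph-β finitary-predOp ｛ suc n ｝)
        (ℕₚ.suc-injective , cong suc)
    ; isZero-0   = ≐-trans (graph-β isZeroOp-finitary ｛ 0 ｝)
        ((λ { (inj₁ (_ , z)) → z ; (inj₂ (_ , () , _)) }) , λ z → inj₁ (refl , z))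
    ; isZero-suc = λ n → ≐-trans (graph-β isZeroOp-finitary ｛ suc n ｝)
        ((λ { (inj₁ (() , _)) ; (inj₂ (_ , _ , z)) → z }) , λ z → inj₂ (n , refl , z))
    ; seq        = λ As → bundle (entries As)
    ; len        = graph (component 0)
    ; proj       = graph₂ projOp
    ; append     = graph₂ λ X A → bundle (appendOp X A)
    ; seq-cong   = λ eqs → bundle-cong (entries-cong eqs)
    ; len-law    = λ As → ≐-trans (graph-β (finitary-component 0) _)
        (component-bundle 0 (entries As))
    ; proj-law   = λ As i → _ , ≐-refl , ≐-trans
        (graph₂-β
          (λ I → finitary-⋃ λ j → finitary-guard j (finitary-const I) (finitary-component (suc j)))
          (λ X → finitary-⋃ λ j → finitary-guard j finitary-id (finitary-const (component (suc j) X)))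
          (bundle (entries As)) ｛ toℕ i ｝)
        (subst (λ X → projOp (bundle (entries As)) ｛ toℕ i ｝ ≐ X) (nth-lookup As i)
          ((λ { (_ , refl , z) → proj₁ (component-bundle (suc (toℕ i)) (entries As)) z }) ,
           (λ z → toℕ i , refl , proj₂ (component-bundle (suc (toℕ i)) (entries As)) z)))
    ; append-law = λ As A → _ , ≐-refl , ≐-trans
        (graph₂-β {λ X A → bundle (appendOp X A)}
          (λ B → finitary-bundle {λ X → appendOp X B} λ
            { zero    → finitary-sucOp (finitary-component 0)
            ; (suc i) → finitary-∪ (finitary-component (suc i))
                          (finitary-guard i (finitary-component 0) (finitary-const B)) })
          (λ X → finitary-bundle {appendOp X} λ
            { zero    → finitary-const (sucOp (component 0 X))
            ; (suc i) → finitary-∪ (finitary-const (component (suc i) X))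
                          (finitary-guard i (finitary-const (component 0 X)) finitary-id) })
          (bundle (entries As)) A)
        (bundle-cong (appendOp-entries As A))
    }
    where
    condOp-β : ∀ B X Y → graph₃ condOp • B • X • Y ≐ condOp B X Y
    condOp-β = graph₃-β
      (λ X Y → finitary-∪ (finitary-guard 1 finitary-id (finitary-const X))
                          (finitary-guard 0 finitary-id (finitary-const Y)))
      (λ B Y → finitary-∪ (finitary-guard 1 (finitary-const B) finitary-id)
                          (finitary-const (guard 0 B Y)))
      (λ B X → finitary-∪ (finitary-const (guard 1 B X))
                          (finitary-guard 0 (finitary-const B) finitary-id))

    isZeroOp-finitary : Finitary isZeroOp
    isZeroOp-finitary = finitary-∪
      (finitary-guard 0 finitary-id (finitary-const _))
      (finitary-⋃ λ i → finitary-guard (suc i) finitary-id (finitary-const _))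

{-# OPTIONS --safe #-}

-- A map that is Scott continuous on V is isotone on V, whereas C is antitone, so
-- C can only be continuous on antichains for ⊆. The set 𝒫(ℕ) contains a chain
-- indexed by 2^ℕ (the lexicographic cuts in the set of binary words), and an
-- antichain meets it in at most one point; so countably many antichains do not
-- cover 𝒫(ℕ), by Cantor's diagonal argument. For (b), a computation of C(A)
-- with oracle F is isotone in A as long as the replies of F are fixed, and there
-- are only countably many finite sequences of replies.
module Submission where

open import Defs
open import Level using (Level; 0ℓ)
open import Axiom.ExcludedMiddle using (ExcludedMiddle)
open import Data.Bool using (Bool; true; false; not; _≟_)
open import Data.Bool.Properties using (not-¬)
open import Data.Empty using (⊥)
open import Data.Fin using (suc)
open import Data.List using (List; []; _∷_; _++_; _∷ʳ_; [_]; tabulate)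
open import Data.List.Properties using (++-assoc; ++-identityʳ; ∷-injective)
open import Data.List.Relation.Binary.Pointwise using (Pointwise; []; _∷_)
open import Data.List.Relation.Unary.Any using (here)
open import Data.Nat using (ℕ; zero; suc)
open import Data.Nat.Binary using (ℕᵇ; zero; 2[1+_]; 1+[2_]; toℕ; fromℕ)
open import Data.Nat.Binary.Properties using (fromℕ-toℕ)
open import Data.Nat.Properties using (suc-injective)
open import Data.Product using (Σ-syntax; ∃-syntax; _×_; _,_; proj₁; proj₂)
open import Data.Product.Properties using (,-injective)
open import Data.Sum using (_⊎_; inj₁; inj₂; map)
open import Data.Vec.Functional using (Vector)
open import Function using (_∘_; id)
open import Function.Bundles using (_↔_; Func; Injection; Inverse; Equivalence)
open import Relation.Binary.Bundles using (Setoid)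
open import Relation.Binary.PropositionalEquality
  using (_≡_; _≢_; refl; sym; trans; cong; subst; subst₂)
open import Relation.Nullary using (¬_; Dec; yes; no; contradiction)
open import Relation.Nullary.Decidable using (decidable-stable)
open import Relation.Unary using (Pred; _∈_; _⊆_; _⊂_; _⊈_; _≐_; ∁; ⋃)

private variable
  c ℓ : Level
  x y : ℕ → Bool
  w   : ℕᵇ

infix 4 _⊏_ _≺_

-- Strict lexicographic order with `false` below `true`; a derivation locates the first difference.
data _⊏_ (x y : ℕ → Bool) : Set where
  head : x 0 ≡ false → y 0 ≡ true → x ⊏ y
  tail : x 0 ≡ y 0 → x ∘ suc ⊏ y ∘ suc → x ⊏ y

-- The first difference lies at or before position `n`, so recursion on `n` finds it.
≢⇒⊏ : ∀ x y n → x n ≢ y n → x ⊏ y ⊎ y ⊏ x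
≢⇒⊏ x y n xₙ≢yₙ with x 0 in x₀ | y 0 in y₀
≢⇒⊏ x y n       _     | false | true  = inj₁ (head x₀ y₀)
≢⇒⊏ x y n       _     | true  | false = inj₂ (head y₀ x₀)
≢⇒⊏ x y zero    x₀≢y₀ | false | false = contradiction (trans x₀ (sym y₀)) x₀≢y₀
≢⇒⊏ x y zero    x₀≢y₀ | true  | true  = contradiction (trans x₀ (sym y₀)) x₀≢y₀
≢⇒⊏ x y (suc n) xₙ≢yₙ | false | false =
  map (tail (trans x₀ (sym y₀))) (tail (trans y₀ (sym x₀))) (≢⇒⊏ (x ∘ suc) (y ∘ suc) n xₙ≢yₙ)
≢⇒⊏ x y (suc n) xₙ≢yₙ | true  | true  =
  map (tail (trans x₀ (sym y₀))) (tail (trans y₀ (sym x₀))) (≢⇒⊏ (x ∘ suc) (y ∘ suc) n xₙ≢yₙ)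

-- A binary numeral in bijective base 2 is read as a binary word: 2[1+_] is the
-- letter false and 1+[2_] the letter true.
data _≺_ : ℕᵇ → (ℕ → Bool) → Set where
  head  : x 0 ≡ true  → 2[1+ w ] ≺ x
  tailᶠ : x 0 ≡ false → w ≺ x ∘ suc → 2[1+ w ] ≺ x
  tailᵗ : x 0 ≡ true  → w ≺ x ∘ suc → 1+[2 w ] ≺ x

≺-⊏-trans : w ≺ x → x ⊏ y → w ≺ y
≺-⊏-trans (head x₀)     (head x₀′ _)  = contradiction (trans (sym x₀) x₀′) λ ()
≺-⊏-trans (head x₀)     (tail eq _)   = head (trans (sym eq) x₀)
≺-⊏-trans (tailᶠ _ _)   (head _ y₀)   = head y₀
≺-⊏-trans (tailᶠ x₀ wx) (tail eq x⊏y) = tailᶠ (trans (sym eq) x₀) (≺-⊏-trans wx x⊏y)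
≺-⊏-trans (tailᵗ x₀ _)  (head x₀′ _)  = contradiction (trans (sym x₀) x₀′) λ ()
≺-⊏-trans (tailᵗ x₀ wx) (tail eq x⊏y) = tailᵗ (trans (sym eq) x₀) (≺-⊏-trans wx x⊏y)

-- The witness is the longest common prefix followed by `false`: it is a prefix of `x`, hence not
-- below `x`, while `y` has `true` at its last letter.
⊏⇒separated : x ⊏ y → ∃[ w ] (w ≺ y × ¬ w ≺ x)
⊏⇒separated (head x₀ y₀) = 2[1+ zero ] , head y₀ ,
  λ { (head x₀′) → contradiction (trans (sym x₀) x₀′) λ () ; (tailᶠ _ ()) }
⊏⇒separated {x} {y} (tail eq x⊏y) with ⊏⇒separated x⊏y | y 0 in y₀
... | w , w≺y , w⊀x | false = 2[1+ w ] , tailᶠ y₀ w≺y ,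
  λ { (head x₀)     → contradiction (trans (sym eq) x₀) λ ()
    ; (tailᶠ _ w≺x) → w⊀x w≺x }
... | w , w≺y , w⊀x | true  = 1+[2 w ] , tailᵗ y₀ w≺y , λ { (tailᵗ _ w≺x) → w⊀x w≺x }

-- A word lies in the cut when at its first disagreement with `x` it has `false` and `x` has `true`;
-- prefixes of `x` are left out.
cut : (ℕ → Bool) → 𝒫ℕ
cut x n = fromℕ n ≺ x

cut-mono : x ⊏ y → cut x ⊂ cut y
cut-mono {x} {y} x⊏y = (λ w≺x → ≺-⊏-trans w≺x x⊏y) , strict
  where
  strict : cut y ⊈ cut x
  strict y⊆x with ⊏⇒separated x⊏y
  ... | w , w≺y , w⊀x =
    w⊀x (subst (_≺ x) (fromℕ-toℕ w) (y⊆x {toℕ w} (subst (_≺ y) (sym (fromℕ-toℕ w)) w≺y)))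

cantor : ExcludedMiddle 0ℓ → (g : (ℕ → Bool) → ℕ) →
         ¬ (∀ x y → g x ≡ g y → ∀ n → x n ≡ y n)
cantor em g injective = differs em refl
  where
  flip : ∀ n → Dec (∃[ x ] g x ≡ n) → Bool
  flip n (yes (x , _)) = not (x n)
  flip n (no _)        = false

  diagonal : ℕ → Bool
  diagonal n = flip n em

  -- The equation ties `d` to the decision made inside `diagonal`, so that the value of `diagonal`
  -- at `g diagonal` is known in the `yes` case.
  differs : (d : Dec (∃[ x ] g x ≡ g diagonal)) → em ≡ d → ⊥
  differs (yes (x , gx≡gd)) em≡ =
    not-¬ (sym (injective x diagonal gx≡gd (g diagonal))) (cong (flip (g diagonal)) em≡)
  differs (no ∄x)           _   = ∄x (diagonal , refl)

-- Common core of (a) and (b): `g` will be the index of a covering set, then the code of a list of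
-- replies. Comparable sets in one fibre would coincide, so `g ∘ cut` would be injective.
complement-not-isotone-on-fibres :
  ExcludedMiddle 0ℓ → (g : 𝒫ℕ → ℕ) →
  ¬ (∀ A B → g A ≡ g B → A ⊆ B → ∁ A ⊆ ∁ B)
complement-not-isotone-on-fibres em g isotone = cantor em (g ∘ cut) injective
  where
  incomparable : ∀ {A B} → g A ≡ g B → ¬ A ⊂ B
  incomparable {A} {B} gA≡gB (A⊆B , B⊈A) =
    B⊈A λ n∈B → decidable-stable em λ n∉A → isotone A B gA≡gB A⊆B n∉A n∈B

  injective : ∀ x y → g (cut x) ≡ g (cut y) → ∀ n → x n ≡ y n
  injective x y eq n = decidable-stable (x n ≟ y n) λ xₙ≢yₙ → absurd (≢⇒⊏ x y n xₙ≢yₙ)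
    where
    absurd : ¬ (x ⊏ y ⊎ y ⊏ x)
    absurd (inj₁ x⊏y) = incomparable eq (cut-mono x⊏y)
    absurd (inj₂ y⊏x) = incomparable (sym eq) (cut-mono y⊏x)

-- Test continuity on the open set of all `X` containing `n`: the open `W` holds a basic
-- neighbourhood `U p` of `A`, and `U p` contains `B`.
continuous⇒isotone : ∀ {ℓ} {V : Pred 𝒫ℕ ℓ} {f} → ContinuousOn V f →
                     ∀ {A B} → A ∈ V → B ∈ V → A ⊆ B → f A ⊆ f B
continuous⇒isotone cont {A} {B} A∈V B∈V A⊆B {n} n∈fA
  with cont (n ∈_) (λ X n∈X → [ n ] , (λ { (here refl) → n∈X }) , λ p⊆X → p⊆X (here refl))
... | W , W-open , preimage with W-open A (Equivalence.to (preimage A A∈V) n∈fA)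
... | p , p⊆A , Uₚ⊆W = Equivalence.from (preimage B B∈V) (Uₚ⊆W (A⊆B ∘ p⊆A))

module _ {S T : Setoid c ℓ} {F : Func S T} (countable : CountableImage F) where
  open Setoid T using (_≈_)
  open Injection countable using (to; injective)

  private
    image : Set _
    image = Setoid.Carrier (imageSetoid F)

  tabulate-injective : ∀ {m n} (b : Vector image m) (b′ : Vector image n) →
    tabulate (to ∘ b) ≡ tabulate (to ∘ b′) →
    Pointwise _≈_ (tabulate (proj₁ ∘ b)) (tabulate (proj₁ ∘ b′))
  tabulate-injective {zero}  {zero}  b b′ eq = []
  tabulate-injective {suc _} {suc _} b b′ eq with ∷-injective eq
  ... | eq₀ , eqs = injective eq₀ ∷ tabulate-injective (b ∘ suc) (b′ ∘ suc) eqs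

module _ (pairing : (ℕ × ℕ) ↔ ℕ) where
  open Inverse pairing using () renaming (to to ⟨_⟩; strictlyInverseʳ to unpair-⟨⟩)
  open GraphModel pairing using (_•_; •-mono; pca)

  listCode : List ℕ → ℕ
  listCode []       = 0
  listCode (k ∷ ks) = suc ⟨ k , listCode ks ⟩

  listCode-injective : ∀ ks ls → listCode ks ≡ listCode ls → ks ≡ ls
  listCode-injective []       []       _  = refl
  listCode-injective (k ∷ ks) (l ∷ ls) eq
    with ,-injective (trans (sym (unpair-⟨⟩ _))
                     (trans (cong (Inverse.from pairing) (suc-injective eq)) (unpair-⟨⟩ _)))
  ... | refl , eqs = cong (k ∷_) (listCode-injective ks ls eqs)

  module _ (K : Coding pca) where
    open Coding K

    private
      •-monoʳ : ∀ A {B B′} → B ⊆ B′ → A • B ⊆ A • B′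
      •-monoʳ A {B} {B′} = •-mono {A} {A} {B} {B′} id

    append-≐ : ∀ As A → append • seq As • A ≐ seq (As ∷ʳ A)
    append-≐ As A with append-law As A
    ... | X , appendAs≐X , XA≐ =
      Setoid.trans 𝒫ℕ-setoid (GraphModel.•-cong pairing appendAs≐X (id , id)) XA≐

    -- `K` is arbitrary, so monotonicity cannot be read off from `seq`. It comes from `append`: each
    -- further entry is added by an application, and application is monotone.
    seq-++-mono : ∀ {As Bs} Cs → seq As ⊆ seq Bs → seq (As ++ Cs) ⊆ seq (Bs ++ Cs)
    seq-++-mono {As} {Bs} [] As⊆Bs =
      subst₂ (λ Xs Ys → seq Xs ⊆ seq Ys) (sym (++-identityʳ As)) (sym (++-identityʳ Bs)) As⊆Bs
    seq-++-mono {As} {Bs} (C ∷ Cs) As⊆Bs =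
      subst₂ (λ Xs Ys → seq Xs ⊆ seq Ys) (++-assoc As [ C ] Cs) (++-assoc Bs [ C ] Cs)
        (seq-++-mono Cs λ n∈ → proj₁ (append-≐ Bs C)
          (•-mono {append • seq As} {append • seq Bs} {C} {C} (•-monoʳ append As⊆Bs) id
            (proj₂ (append-≐ As C) n∈)))

    seq-∷-mono : ∀ {A B} Cs → A ⊆ B → seq (A ∷ Cs) ⊆ seq (B ∷ Cs)
    seq-∷-mono {A} {B} Cs A⊆B = seq-++-mono Cs λ n∈ →
      proj₁ (append-≐ [] B) (•-monoʳ (append • seq []) A⊆B (proj₂ (append-≐ [] A) n∈))

    snd-reflects-⊆ : ∀ {A A′ B B′} → ⟪ A , B ⟫ ⊆ ⟪ A′ , B′ ⟫ → B ⊆ B′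
    snd-reflects-⊆ P⊆P′ n∈B =
      proj₁ (snd-law _ _) (•-monoʳ snd P⊆P′ (proj₂ (snd-law _ _) n∈B))

    module _ (F : Func 𝒫ℕ-setoid 𝒫ℕ-setoid) (countable : CountableImage F) where
      open Oracle K (total F) using (_·ᶠ_⇓_)

      replies : ∀ R {A B} → R ·ᶠ A ⇓ B → List ℕ
      replies _ (_ , e , r , Fe≐r , _) =
        tabulate λ i → Injection.to countable (r i , e i , Fe≐r i)

      -- The two runs are compared at their halting stage: with equal replies, the final inputs to
      -- `R` differ only in the first entry, and `snd` strips the flag `T` monotonically.
      same-replies⇒isotone : ∀ R {A A′ B B′} (h : R ·ᶠ A ⇓ B) (h′ : R ·ᶠ A′ ⇓ B′) →
                             replies R h ≡ replies R h′ → A ⊆ A′ → B ⊆ B′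
      same-replies⇒isotone R {A} {A′} {B} {B′}
        (_ , e , r , Fe≐r , _ , RA≐B) (_ , e′ , r′ , Fe′≐r′ , _ , RA′≐B′) eq A⊆A′ =
        snd-reflects-⊆ λ n∈ →
          proj₁ RA′≐B′ (•-monoʳ R inputs⊆ (proj₂ RA≐B n∈))
        where
        r≐r′ : Pointwise _≐_ (tabulate r) (tabulate r′)
        r≐r′ = tabulate-injective {F = F} countable
                 (λ i → r i , e i , Fe≐r i) (λ i → r′ i , e′ i , Fe′≐r′ i) eq

        inputs⊆ : seq (A ∷ tabulate r) ⊆ seq (A′ ∷ tabulate r′)
        inputs⊆ n∈ =
          proj₁ (seq-cong ((id , id) ∷ r≐r′)) (seq-∷-mono (tabulate r) A⊆A′ n∈)

theorem3p2 : ∀ {ℓ : Level} → ExcludedMiddle 0ℓ →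
    ( ¬ (Σ[ V ∈ (ℕ → Pred 𝒫ℕ ℓ) ]
    ( (∀ A → A ∈ ⋃ ℕ V)
    × (∀ i → ContinuousOn (V i) (Func.to complement)) )) )
    ×
    ( (pairing : (ℕ × ℕ) ↔ ℕ) (K : Coding (GraphModel.pca pairing))
    (F : Func 𝒫ℕ-setoid 𝒫ℕ-setoid) → CountableImage F →
    ¬ Representable (Oracle.oracleStructure K (total F)) (total complement) )
theorem3p2 em =
  -- `cover` assigns one index to each set, so a fibre lies within a single `V i`.
  (λ { (V , cover , cont) → complement-not-isotone-on-fibres em (proj₁ ∘ cover)
         λ A B eq → continuous⇒isotone (cont (proj₁ (cover A)))
           (proj₂ (cover A)) (subst (λ i → B ∈ V i) (sym eq) (proj₂ (cover B))) }) ,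
  λ { pairing K F countable (R , represents) →
        -- `complement` is total, so `R` halts on every `A` and its list of replies is defined.
        let run = λ A → represents A (∁ A) (id , id) in
        complement-not-isotone-on-fibres em
          (λ A → listCode pairing (replies pairing K F countable R (run A)))
          λ A B eq → same-replies⇒isotone pairing K F countable R (run A) (run B)
            (listCode-injective pairing _ _ eq) }
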